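{- Let $T$ be a tournament of diameter $d$ (in particular $T$ is strongly connected). (a) If $d=2$, then $3\le\overrightarrow{trc}(T)\le 5$. (b) If $d\ge 3$, then $2d-1\le\overrightarrow{trc}(T)\le 2d+7$.
   Context: A tournament is a digraph in which every two distinct vertices are joined by exactly one arc (in one direction), with no loops. The distance $d(u,v)$ is the length (number of arcs) of a shortest directed $u$–$v$ path, and the diameter is $\max_{u,v}d(u,v)$. A directed path is total-rainbow if its arcs and internal vertices all receive pairwise distinct colours under a total-colouring (colouring of vertices and arcs). $\overrightarrow{trc}(T)$ is the minimum number of colours in a total-colouring of $T$ such that every ordered pair $(u,v)$ of vertices is joined by a total-rainbow $u$–$v$ path. -}

module Defs where

open import Data.Nat using (ℕ; suc; _≤_; _<_)
open import Data.Fin using (Fin)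
open import Data.Bool using (Bool; true; false)
open import Data.List using (List; []; _∷_; _++_; length)
open import Data.List.Relation.Unary.Unique.Propositional using (Unique)
open import Data.Product using (_×_; Σ; ∃; ∃-syntax; _,_)
open import Relation.Binary.PropositionalEquality using (_≡_; _≢_)

record Tournament (n : ℕ) : Set where
  field
    arc      : Fin n → Fin n → Bool
    loopless : ∀ u → arc u u ≡ false
    oneArc   : ∀ u v → u ≢ v → arc u v ≢ arc v u

open Tournament public

Arc : ∀ {n} → Tournament n → Fin n → Fin n → Set
Arc T u v = arc T u v ≡ true

-- A directed walk from u to v, given by the list ws of vertices visited after u
-- (so it has length ws arcs; ws = [] means u ≡ v).
WalkFrom : ∀ {n} → Tournament n → Fin n → List (Fin n) → Fin n → Set
WalkFrom T u []       v = u ≡ v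
WalkFrom T u (w ∷ ws) v = Arc T u w × WalkFrom T w ws v

IsPath : ∀ {n} → Tournament n → Fin n → List (Fin n) → Fin n → Set
IsPath T u ws v = WalkFrom T u ws v × Unique (u ∷ ws)

DistLE : ∀ {n} → Tournament n → Fin n → Fin n → ℕ → Set
DistLE T u v k = Σ (List _) λ ws → IsPath T u ws v × length ws ≤ k

HasDiameter : ∀ {n} → Tournament n → ℕ → Set
HasDiameter T d =
  (∀ u v → DistLE T u v d) ×
  (∃[ u ] ∃[ v ] (∀ ws → IsPath T u ws v → d ≤ length ws))

-- A total-colouring of T with k colours (colours of vertices and of arcs;
-- the value of arcCol on non-arcs is irrelevant).
record TotalColouring {n} (T : Tournament n) (k : ℕ) : Set where
  field
    vertCol : Fin n → Fin k
    arcCol  : Fin n → Fin n → Fin k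

open TotalColouring public

arcColours : ∀ {n k} {T : Tournament n} → TotalColouring T k → Fin n → List (Fin n) → List (Fin k)
arcColours c u []       = []
arcColours c u (w ∷ ws) = arcCol c u w ∷ arcColours c w ws

internalColours : ∀ {n k} {T : Tournament n} → TotalColouring T k → List (Fin n) → List (Fin k)
internalColours c []            = []
internalColours c (w ∷ [])      = []
internalColours c (w ∷ w' ∷ ws) = vertCol c w ∷ internalColours c (w' ∷ ws)

TotalRainbow : ∀ {n k} {T : Tournament n} → TotalColouring T k → Fin n → List (Fin n) → Set
TotalRainbow c u ws = Unique (arcColours c u ws ++ internalColours c ws)

TotalRainbowConnected : ∀ {n k} {T : Tournament n} → TotalColouring T k → Set
TotalRainbowConnected {T = T} c =
  ∀ u v → u ≢ v → Σ (List _) λ ws → IsPath T u ws v × TotalRainbow c u ws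

IsTRC : ∀ {n} → Tournament n → ℕ → Set
IsTRC T k =
  (Σ (TotalColouring T k) TotalRainbowConnected) ×
  (∀ k' → Σ (TotalColouring T k') TotalRainbowConnected → k ≤ k')

module Submission where

-- Lower bounds: a rainbow path of length l uses l + (l - 1) colours.
--
-- Diameter 2: fix a vertex r and colour arcs and vertices according to whether their ends are r,
-- out-neighbours or in-neighbours of r; paths of length at most 3 through r suffice.
--
-- Diameter d ≥ 3: let r have minimum out-degree, and let level v be the distance from r to v.
-- Follow a breadth-first tree down from r; a vertex of level ≥ 2 has an arc back to r.  A vertex u
-- of level 1 returns to r through some w in W u, the set of its out-neighbours of level 2, which
-- fails only if w has the colour of the second vertex p₂ of the tree path p₁ p₂ …, and if p₁ → u.
-- Hence it suffices to colour level 2 with 4 colours so that W u is not monochromatic whenever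
-- |W u| ≥ 2.  By minimality of r, |W u| exceeds the in-degree of u within level 1.  So colour
-- greedily: given m + 1 vertices of level 1, some u among them has in-degree at least m / 2 there.
-- Treat the other m first, then split W u with at most two new coloured vertices, alternating
-- between two pairs of colours; all classes had size at most ⌈m / 2⌉ < |W u|, so this is possible.
-- This uses d + 3 ranks (4 for level 2); vertices get their ranks, and arcs their heads' ranks
-- in a second palette.

open import Defs
open import Data.Bool using (Bool; true; false; not; _∧_; if_then_else_)
import Data.Bool as Bool using (T)
import Data.Bool.Properties as Bool
open import Data.Fin using (Fin; zero; suc; toℕ; fromℕ<; combine; remQuot; finToFun; funToFin)
open import Data.Fin.Properties using (any?; all?; injective⇒≤; finToFun-funToFin; remQuot-combine; toℕ<n; toℕ-injective; toℕ-fromℕ<)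
  renaming (_≟_ to _≟ᶠ_)
open import Data.List using (List; []; _∷_; [_]; _++_; _∷ʳ_; length; map; lookup; filterᵇ; allFin)
open import Data.List.Properties using (length-++)
import Data.List.Membership.DecPropositional as DecMembership
open import Data.List.Membership.Propositional using (_∈_; _∉_; find)
open import Data.List.Membership.Propositional.Properties using (∈-lookup; ∈-allFin; ∈-filter⁺; ∈-∃++)
open import Data.List.Relation.Binary.Permutation.Propositional using (↭-sym)
open import Data.List.Relation.Binary.Permutation.Propositional.Properties using (shift; ↭-length; ∈-resp-↭)
  renaming (map⁺ to ↭-map⁺)
open import Data.List.Relation.Unary.All as All using (All; []; _∷_)
open import Data.List.Relation.Unary.Any as Any using (here; there)
open import Data.List.Relation.Unary.AllPairs as AllPairs using (AllPairs; []; _∷_)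
import Data.List.Relation.Unary.All.Properties as All
open import Data.List.Relation.Unary.Unique.Propositional using (Unique)
import Data.List.Relation.Unary.Unique.Propositional.Properties as Unique
import Data.List.Relation.Unary.Unique.DecPropositional as DecUnique
open import Data.Maybe using (Maybe; just; nothing; maybe′)
import Data.Maybe.Properties as Maybe
open import Data.Nat
open import Data.Nat.ListAction using (sum)
open import Data.Nat.ListAction.Properties using (sum-↭)
open import Data.Nat.Properties
import Data.List.Extrema ≤-totalOrder as Extrema
open import Data.Nat.Solver using (module +-*-Solver)
open import Data.Product using (Σ; _×_; ∃; ∃-syntax; _,_; proj₁; proj₂; uncurry)
open import Data.Product.Properties using (≡-dec)
open import Data.Sum using (_⊎_; inj₁; inj₂)
open import Data.Unit using (⊤; tt)
open import Function using (_∘_; id; case_of_)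
open import Relation.Nullary using (¬_; Dec; yes; no; does; contradiction)
open import Relation.Nullary.Decidable using (map′; _×-dec_; _⊎-dec_; _→-dec_; ¬?; True; toWitness)
open import Relation.Unary using (Decidable)
open import Relation.Binary.PropositionalEquality using (_≡_; _≢_; refl; sym; trans; cong; cong₂; subst)

open +-*-Solver using (solve; _:+_; _:*_; _:=_; con)

private variable
  n k d : ℕ

least : {P : ℕ → Set} → Decidable P → ∀ n → P n → ∃[ m ] (P m × (∀ j → P j → m ≤ j))
least P? n pn with P? 0
... | yes p0 = 0 , p0 , λ _ _ → z≤n
least P? zero pn | no ¬p0 = contradiction pn ¬p0
least P? (suc n) pn | no ¬p0 with m , pm , min ← least (P? ∘ suc) n pn =
  suc m , pm , λ { zero p0 → contradiction p0 ¬p0 ; (suc j) pj → s≤s (min j pj) }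

-- Existence of trc and the lower bound

Unique⇒length≤ : ∀ {xs : List (Fin k)} → Unique xs → length xs ≤ k
Unique⇒length≤ uniq = injective⇒≤ (lookup-injective uniq)
  where
  lookup-injective : ∀ {xs : List (Fin k)} → Unique xs → ∀ {i j} → lookup xs i ≡ lookup xs j → i ≡ j
  lookup-injective (_ ∷ _)   {zero}  {zero}  _  = refl
  lookup-injective (x∉ ∷ _)  {zero}  {suc j} eq = contradiction eq (All.lookup x∉ (∈-lookup j))
  lookup-injective (x∉ ∷ _)  {suc i} {zero}  eq = contradiction (sym eq) (All.lookup x∉ (∈-lookup i))
  lookup-injective (_ ∷ uxs) {suc i} {suc j} eq = cong suc (lookup-injective uxs eq)

module _ {T : Tournament n} (c : TotalColouring T k) where

  length-arcColours : ∀ u ws → length (arcColours c u ws) ≡ length ws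
  length-arcColours u []       = refl
  length-arcColours u (w ∷ ws) = cong suc (length-arcColours w ws)

  length-internalColours : ∀ ws → length (internalColours c ws) ≡ length ws ∸ 1
  length-internalColours []            = refl
  length-internalColours (w ∷ [])      = refl
  length-internalColours (w ∷ w′ ∷ ws) = cong suc (length-internalColours (w′ ∷ ws))

  rainbow-length : ∀ u ws → TotalRainbow c u ws → length ws + (length ws ∸ 1) ≤ k
  rainbow-length u ws rb = subst (_≤ k)
    (trans (length-++ (arcColours c u ws)) (cong₂ _+_ (length-arcColours u ws) (length-internalColours ws)))
    (Unique⇒length≤ rb)

-- Two vertices realising the diameter `suc d` force a path of at least that length, and the bound
-- of `rainbow-length` grows with the length. As the diameter is a successor, the two vertices
-- differ, and twice the diameter minus one reads `suc d + d`.
lower-bound : {T : Tournament n} → HasDiameter T (suc d) → (c : TotalColouring T k) →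
              TotalRainbowConnected c → suc d + d ≤ k
lower-bound {d = d} (_ , u , v , far) c conn with u ≟ᶠ v
... | yes refl = contradiction (far [] (refl , [] ∷ [])) λ ()
... | no u≢v with ws , path , rb ← conn u v u≢v =
  ≤-trans (+-mono-≤ (far ws path) (∸-monoˡ-≤ 1 (far ws path))) (rainbow-length c u ws rb)

-- Deciding whether a rainbow connected colouring exists

walk? : (T : Tournament n) → ∀ u ws v → Dec (WalkFrom T u ws v)
walk? T u []       v = u ≟ᶠ v
walk? T u (w ∷ ws) v = (arc T u w Bool.≟ true) ×-dec walk? T w ws v

path? : (T : Tournament n) → ∀ u ws v → Dec (IsPath T u ws v)
path? T u ws v = walk? T u ws v ×-dec DecUnique.unique? _≟ᶠ_ (u ∷ ws)

-- The length bound `b` makes the search over lists finite.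
anyList? : ∀ b {P : List (Fin n) → Set} → Decidable P → (∀ {ws} → P ws → length ws ≤ b) → Dec (∃ P)
anyList? zero P? short with P? []
... | yes p = yes ([] , p)
... | no ¬p = no λ { ([] , p) → ¬p p ; (w ∷ ws , p) → case short p of λ () }
anyList? (suc b) P? short with P? []
... | yes p = yes ([] , p)
... | no ¬p = map′ (λ (w , ws , p) → w ∷ ws , p)
                   (λ { ([] , p) → contradiction p ¬p ; (w ∷ ws , p) → w , ws , p })
                   (any? λ w → anyList? b (P? ∘ (w ∷_)) (s≤s⁻¹ ∘ short))

connected? : {T : Tournament n} (c : TotalColouring T k) → Dec (TotalRainbowConnected c)
connected? {n = n} {T = T} c = all? λ u → all? λ v → ¬? (u ≟ᶠ v) →-dec
  -- A path has distinct vertices, at most `n` of them with the first one included.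
  anyList? n (λ ws → path? T u ws v ×-dec DecUnique.unique? _≟ᶠ_ _)
    λ ((_ , uniq) , _) → <⇒≤ (Unique⇒length≤ uniq)

module _ {T : Tournament n} {c c′ : TotalColouring T k}
         (vert : ∀ v → vertCol c v ≡ vertCol c′ v) (arcs : ∀ u v → arcCol c u v ≡ arcCol c′ u v) where

  arcColours-cong : ∀ u ws → arcColours c u ws ≡ arcColours c′ u ws
  arcColours-cong u []       = refl
  arcColours-cong u (w ∷ ws) = cong₂ _∷_ (arcs u w) (arcColours-cong w ws)

  internalColours-cong : ∀ ws → internalColours c ws ≡ internalColours c′ ws
  internalColours-cong []            = refl
  internalColours-cong (w ∷ [])      = refl
  internalColours-cong (w ∷ w′ ∷ ws) = cong₂ _∷_ (vert w) (internalColours-cong (w′ ∷ ws))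

  -- Decoding an encoded colouring returns functions that agree with the original pointwise, so
  -- connectedness is transported along pointwise agreement.
  connected-cong : TotalRainbowConnected c → TotalRainbowConnected c′
  connected-cong conn u v u≢v with ws , path , rb ← conn u v u≢v =
    ws , path , subst Unique (cong₂ _++_ (arcColours-cong u ws) (internalColours-cong ws)) rb

-- Finitely many cases: vertex colours are coded in `Fin (k ^ n)`, and arc colours, as functions of
-- `combine u v`, in `Fin (k ^ (n * n))`.
colouring? : (T : Tournament n) → ∀ k → Dec (Σ (TotalColouring T k) TotalRainbowConnected)
colouring? {n = n} T k = map′
  (λ (i , j , conn) → decode i j , conn)
  (λ (c , conn) → funToFin (vertCol c) , funToFin (uncurry (arcCol c) ∘ remQuot n) ,
    connected-cong (λ v → sym (finToFun-funToFin (vertCol c) v))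
      (λ u v → sym (trans (finToFun-funToFin (uncurry (arcCol c) ∘ remQuot n) (combine u v))
                          (cong (uncurry (arcCol c)) (remQuot-combine u v))))
      conn)
  (any? λ i → any? λ j → connected? (decode i j))
  where
  decode : Fin (k ^ n) → Fin (k ^ (n * n)) → TotalColouring T k
  decode i j = record { vertCol = finToFun i ; arcCol = λ u v → finToFun j (combine u v) }

-- Decidability yields a least number of colours, with `k` as the start of the search; an upper
-- bound then amounts to exhibiting one colouring.
trc-exists : (T : Tournament n) → HasDiameter T (suc d) → (c : TotalColouring T k) → TotalRainbowConnected c →
             ∃[ m ] (IsTRC T m × suc d + d ≤ m × m ≤ k)
trc-exists {k = k} T diam c conn with m , (c′ , conn′) , min ← least (colouring? T) k (c , conn) =
  m , ((c′ , conn′) , min) , lower-bound diam c′ conn′ , min k (c , conn)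

-- Diameter two

∉⇒All≢ : ∀ {A : Set} {x : A} {xs} → x ∉ xs → All (x ≢_) xs
∉⇒All≢ x∉xs = All.¬Any⇒All¬ _ x∉xs

module _ (T : Tournament n) where

  Arc⇒≢ : ∀ {u v} → Arc T u v → u ≢ v
  Arc⇒≢ {u} uv refl with () ← trans (sym uv) (loopless T u)

  Arc-asym : ∀ {u v} → Arc T u v → ¬ Arc T v u
  Arc-asym {u} {v} uv vu = oneArc T u v (Arc⇒≢ uv) (trans uv (sym vu))

  Arc-total : ∀ {u v} → u ≢ v → ¬ Arc T u v → Arc T v u
  Arc-total {u} {v} u≢v ¬uv with arc T u v | arc T v u | oneArc T u v u≢v
  ... | _     | true  | _    = refl
  ... | true  | false | _    = contradiction refl ¬uv
  ... | false | false | diff = contradiction refl diff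

module DiameterTwo (T : Tournament n) (r : Fin n) (near : ∀ u v → DistLE T u v 2) where

  data Kind : Set where
    root out inn : Kind

  Is : Kind → Fin n → Set
  Is root v = v ≡ r
  Is out  v = Arc T r v
  Is inn  v = Arc T v r

  kindOf : ∀ v → ∃[ κ ] Is κ v
  kindOf v with v ≟ᶠ r | arc T r v in rv
  ... | yes v≡r | _     = root , v≡r
  ... | no _    | true  = out , rv
  ... | no v≢r  | false = inn , Arc-total T (v≢r ∘ sym) λ rv′ → case trans (sym rv) rv′ of λ ()

  kind : Fin n → Kind
  kind v = proj₁ (kindOf v)

  kind-unique : ∀ {κ v} → Is κ v → kind v ≡ κ
  kind-unique {κ} {v} is with kindOf v
  kind-unique {root} refl | root , _    = refl
  kind-unique {root} refl | out  , rr   = contradiction refl (Arc⇒≢ T rr)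
  kind-unique {root} refl | inn  , rr   = contradiction refl (Arc⇒≢ T rr)
  kind-unique {out}  rv   | root , refl = contradiction refl (Arc⇒≢ T rv)
  kind-unique {out}  _    | out  , _    = refl
  kind-unique {out}  rv   | inn  , vr   = contradiction vr (Arc-asym T rv)
  kind-unique {inn}  vr   | root , refl = contradiction refl (Arc⇒≢ T vr)
  kind-unique {inn}  vr   | out  , rv   = contradiction vr (Arc-asym T rv)
  kind-unique {inn}  _    | inn  , _    = refl

  vertKindCol : Kind → Fin 5
  vertKindCol root = suc (suc (suc (suc zero)))
  vertKindCol _    = suc (suc (suc zero))

  -- Along out, inn, root, out the arcs get 1, 2, 0, so up to three consecutive ones differ. Arcs
  -- inside inn get 2 and not 1, to make out, inn, inn rainbow.
  arcKindCol : Kind → Kind → Fin 5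
  arcKindCol _    root = suc (suc zero)
  arcKindCol _    out  = zero
  arcKindCol inn  inn  = suc (suc zero)
  arcKindCol _    inn  = suc zero

  colouring : TotalColouring T 5
  colouring = record { vertCol = vertKindCol ∘ kind ; arcCol = λ u v → arcKindCol (kind u) (kind v) }

  Joined : Fin n → Fin n → Set
  Joined u v = Σ (List (Fin n)) λ ws → IsPath T u ws v × TotalRainbow colouring u ws

  direct : ∀ {u v} → Arc T u v → Joined u v
  direct {v = v} uv = [ v ] , ((uv , refl) , (Arc⇒≢ T uv ∷ []) ∷ [] ∷ []) , [] ∷ []

  Via₁ : Kind → Kind → Kind → Set
  Via₁ a b c = Unique (arcKindCol a b ∷ arcKindCol b c ∷ vertKindCol b ∷ [])

  via₁? : ∀ a b c → Dec (Via₁ a b c)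
  via₁? a b c = DecUnique.unique? _≟ᶠ_ _

  -- Being rainbow depends only on the kinds of the vertices, so `rb` is settled by evaluation.
  via₁ : ∀ {u w v} {a b c} → Is a u → Is b w → Is c v → Arc T u w → Arc T w v → u ≢ v → {rb : True (via₁? a b c)} → Joined u v
  via₁ {u} {w} {v} {a} {b} {c} ua wb vc uw wv u≢v {rb} =
    w ∷ v ∷ [] , ((uw , wv , refl) , (Arc⇒≢ T uw ∷ u≢v ∷ []) ∷ (Arc⇒≢ T wv ∷ []) ∷ [] ∷ []) , rainbow
    where
    rainbow : Via₁ (kind u) (kind w) (kind v)
    rainbow rewrite kind-unique {a} {u} ua | kind-unique {b} {w} wb | kind-unique {c} {v} vc = toWitness rb

  Via₂ : Kind → Kind → Kind → Kind → Set
  Via₂ a b c d = Unique (arcKindCol a b ∷ arcKindCol b c ∷ arcKindCol c d ∷ vertKindCol b ∷ vertKindCol c ∷ [])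

  via₂? : ∀ a b c d → Dec (Via₂ a b c d)
  via₂? a b c d = DecUnique.unique? _≟ᶠ_ _

  via₂ : ∀ {u w x v} {a b c d} → Is a u → Is b w → Is c x → Is d v → Arc T u w → Arc T w x → Arc T x v →
         u ≢ x → u ≢ v → w ≢ v → {rb : True (via₂? a b c d)} → Joined u v
  via₂ {u} {w} {x} {v} {a} {b} {c} {d} ua wb xc vd uw wx xv u≢x u≢v w≢v {rb} =
    w ∷ x ∷ v ∷ [] , ((uw , wx , xv , refl) ,
      (Arc⇒≢ T uw ∷ u≢x ∷ u≢v ∷ []) ∷ (Arc⇒≢ T wx ∷ w≢v ∷ []) ∷ (Arc⇒≢ T xv ∷ []) ∷ [] ∷ []) , rainbow
    where
    rainbow : Via₂ (kind u) (kind w) (kind x) (kind v)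
    rainbow rewrite kind-unique {a} {u} ua | kind-unique {b} {w} wb | kind-unique {c} {x} xc | kind-unique {d} {v} vd = toWitness rb

  midpoint : ∀ {u v} → u ≢ v → ¬ Arc T u v → ∃[ w ] (Arc T u w × Arc T w v)
  midpoint {u} {v} u≢v ¬uv with near u v
  ... | [] , (u≡v , _) , _ = contradiction u≡v u≢v
  ... | w ∷ [] , ((uw , refl) , _) , _ = contradiction uw ¬uv
  ... | w ∷ x ∷ [] , ((uw , wx , refl) , _) , _ = w , uw , wx
  ... | _ ∷ _ ∷ _ ∷ _ , _ , s≤s (s≤s ())

  arc? : ∀ u v → Dec (Arc T u v)
  arc? u v = arc T u v Bool.≟ true

  connected : TotalRainbowConnected colouring
  connected u v u≢v with arc? u v
  ... | yes uv = direct uv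
  ... | no ¬uv with kindOf u | kindOf v
  ...   | root , refl | root , refl = contradiction refl u≢v
  ...   | root , refl | out  , rv   = contradiction rv ¬uv
  ...   | inn  , ur   | root , refl = contradiction ur ¬uv
  ...   | inn  , ur   | out  , rv   =
    via₁ {a = inn} {root} {out} ur refl rv ur rv u≢v
  ...   | root , refl | inn  , vr with w , rw , wv ← midpoint u≢v ¬uv =
    via₁ {a = root} {out} {inn} refl rw vr rw wv u≢v
  connected u v u≢v | no ¬uv | out  , ru   | root , refl with w , uw , wr ← midpoint u≢v ¬uv =
    via₁ {a = out} {inn} {root} ru wr refl uw wr u≢v
  -- As `r` leads to `u`, some midpoint `w` leads from `u` back to `r`; it is an in-neighbour of
  -- `r`, and `r` leads to `v`.
  connected u v u≢v | no ¬uv | out  , ru   | out  , rv with w , uw , wr ← midpoint (Arc⇒≢ T ru ∘ sym) (Arc-asym T ru) =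
    via₂ {a = out} {inn} {root} {out} ru wr refl rv uw wr rv
      (Arc⇒≢ T ru ∘ sym) u≢v (λ { refl → Arc-asym T wr rv })
  -- The mirror image: first the arc to `r`, then a midpoint of `r` and `v`.
  connected u v u≢v | no ¬uv | inn  , ur   | inn  , vr with w , rw , wv ← midpoint (Arc⇒≢ T vr ∘ sym) (Arc-asym T vr) =
    via₂ {a = inn} {root} {out} {inn} ur refl rw vr ur rw wv
      (λ { refl → Arc-asym T ur rw }) u≢v (Arc⇒≢ T vr ∘ sym)
  -- The midpoint of `u` and `v` may lie on either side of `r`; both give distinct colours.
  connected u v u≢v | no ¬uv | out  , ru   | inn  , vr with w , uw , wv ← midpoint u≢v ¬uv with kindOf w
  ... | root , refl = contradiction uw (Arc-asym T ru)
  ... | out  , rw   = via₁ {a = out} {out} {inn} ru rw vr uw wv u≢v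
  ... | inn  , wr   = via₁ {a = out} {inn} {inn} ru wr vr uw wv u≢v

-- Counting in tournaments

∑ : {A : Set} → (A → ℕ) → List A → ℕ
∑ f xs = sum (map f xs)

bit : Bool → ℕ
bit true  = 1
bit false = 0

count : {A : Set} → (A → Bool) → List A → ℕ
count p = ∑ (bit ∘ p)

module _ {A : Set} where

  ∑-mono : {f g : A → ℕ} → (∀ x → f x ≤ g x) → ∀ xs → ∑ f xs ≤ ∑ g xs
  ∑-mono f≤g []       = z≤n
  ∑-mono f≤g (x ∷ xs) = +-mono-≤ (f≤g x) (∑-mono f≤g xs)

  ∑-cong : {f g : A → ℕ} → (∀ x → f x ≡ g x) → ∀ xs → ∑ f xs ≡ ∑ g xs
  ∑-cong f≡g []       = refl
  ∑-cong f≡g (x ∷ xs) = cong₂ _+_ (f≡g x) (∑-cong f≡g xs)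

  ∑-distrib-+ : (f g : A → ℕ) → ∀ xs → ∑ (λ x → f x + g x) xs ≡ ∑ f xs + ∑ g xs
  ∑-distrib-+ f g []       = refl
  ∑-distrib-+ f g (x ∷ xs) = trans (cong (f x + g x +_) (∑-distrib-+ f g xs))
    (solve 4 (λ a b c d → (a :+ b) :+ (c :+ d) := (a :+ c) :+ (b :+ d)) refl (f x) (g x) (∑ f xs) (∑ g xs))

  ∑-≤-length : ∀ {f : A → ℕ} {b xs} → All (λ x → f x ≤ b) xs → ∑ f xs ≤ length xs * b
  ∑-≤-length []           = z≤n
  ∑-≤-length (px ∷ pxs) = +-mono-≤ px (∑-≤-length pxs)

  length-≤-∑ : ∀ {f : A → ℕ} → (∀ x → 1 ≤ f x) → ∀ xs → length xs ≤ ∑ f xs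
  length-≤-∑ 1≤f []       = z≤n
  length-≤-∑ 1≤f (x ∷ xs) = +-mono-≤ (1≤f x) (length-≤-∑ 1≤f xs)

  count-filter : (p q : A → Bool) → ∀ xs → count p (filterᵇ q xs) ≡ count (λ x → q x ∧ p x) xs
  count-filter p q []       = refl
  count-filter p q (x ∷ xs) with q x
  ... | true  = cong (bit (p x) +_) (count-filter p q xs)
  ... | false = count-filter p q xs

  count-<⇒∃ : {p q : A → Bool} → ∀ xs → count p xs < count q xs → ∃[ x ] (q x ≡ true × p x ≡ false)
  count-<⇒∃ {p} {q} (x ∷ xs) lt with p x in px | q x in qx
  ... | false | true  = x , qx , px
  ... | false | false = count-<⇒∃ xs lt
  ... | true  | true  = count-<⇒∃ xs (s≤s⁻¹ lt)
  ... | true  | false = count-<⇒∃ xs (<⇒≤ lt)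

  count-≥1⇒∃ : {p : A → Bool} → ∀ xs → 1 ≤ count p xs → ∃[ x ] p x ≡ true
  count-≥1⇒∃ {p} (x ∷ xs) 1≤ with p x in px
  ... | true  = x , px
  ... | false = count-≥1⇒∃ xs 1≤

  ∈⇒count≥1 : ∀ {p : A → Bool} {x xs} → x ∈ xs → p x ≡ true → 1 ≤ count p xs
  ∈⇒count≥1 (here refl) px rewrite px = s≤s z≤n
  ∈⇒count≥1 (there x∈)  px = m≤n⇒m≤o+n _ (∈⇒count≥1 x∈ px)

  ∈∈⇒count≥2 : ∀ {p : A → Bool} {x y xs} → x ≢ y → x ∈ xs → y ∈ xs → p x ≡ true → p y ≡ true → 2 ≤ count p xs
  ∈∈⇒count≥2 x≢y (here refl) (here refl) px py = contradiction refl x≢y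
  ∈∈⇒count≥2 x≢y (here refl) (there y∈)  px py rewrite px = s≤s (∈⇒count≥1 y∈ py)
  ∈∈⇒count≥2 x≢y (there x∈)  (here refl) px py rewrite py = s≤s (∈⇒count≥1 x∈ px)
  ∈∈⇒count≥2 x≢y (there x∈)  (there y∈)  px py = m≤n⇒m≤o+n _ (∈∈⇒count≥2 x≢y x∈ y∈ px py)

# : (Fin n → Bool) → ℕ
# p = count p (allFin _)

is : Fin n → Fin n → Bool
is x y = does (x ≟ᶠ y)

#-is≤1 : (x : Fin n) → # (is x) ≤ 1
#-is≤1 x = go (Unique.allFin⁺ _)
  where
  none : ∀ {xs} → All (x ≢_) xs → count (is x) xs ≡ 0
  none []             = refl
  none {y ∷ _} (x≢y ∷ x∉) with x ≟ᶠ y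
  ... | yes x≡y = contradiction x≡y x≢y
  ... | no _    = none x∉
  go : ∀ {xs} → Unique xs → count (is x) xs ≤ 1
  go []           = z≤n
  go {y ∷ _} (y∉ ∷ uxs) with x ≟ᶠ y
  ... | yes refl = ≤-reflexive (cong suc (none y∉))
  ... | no _     = go uxs

module _ (T : Tournament n) where

  -- Holds for the in-neighbours `x` of `u` and for `u` itself. Counting `u` along with its
  -- in-degree turns strict bounds on in-degrees into weak ones.
  beats : Fin n → Fin n → Bool
  beats u x = not (arc T u x)

  -- Induction on `S`: a new `x` counts itself once, and each pair of `x` with an earlier `u` is
  -- counted from at least one side.
  count-beats-total : ∀ S → length S * suc (length S) ≤ 2 * ∑ (λ u → count (beats u) S) S
  count-beats-total []       = z≤n
  count-beats-total (x ∷ S) = begin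
    suc L * suc (suc L)                ≡⟨ solve 1 (λ l → (con 1 :+ l) :* (con 2 :+ l) := con 2 :* (con 1 :+ l) :+ l :* (con 1 :+ l)) refl L ⟩
    2 * suc L + L * suc L              ≤⟨ +-mono-≤ (*-monoʳ-≤ 2 (s≤s pairs)) (count-beats-total S) ⟩
    2 * suc (P + R) + 2 * Q            ≡⟨ solve 3 (λ p r q → con 2 :* (con 1 :+ (p :+ r)) :+ con 2 :* q := con 2 :* ((con 1 :+ p) :+ (r :+ q))) refl P R Q ⟩
    2 * (suc P + (R + Q))              ≡⟨ cong (λ b → 2 * (bit b + P + (R + Q))) (cong not (sym (loopless T x))) ⟩
    2 * (bit (beats x x) + P + (R + Q)) ≡⟨ cong (λ m → 2 * (bit (beats x x) + P + m)) (sym (∑-distrib-+ (λ u → bit (beats u x)) (λ u → count (beats u) S) S)) ⟩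
    2 * ∑ (λ u → count (beats u) (x ∷ S)) (x ∷ S) ∎
    where
    open ≤-Reasoning
    L P Q R : ℕ
    L = length S
    P = count (beats x) S
    Q = ∑ (λ u → count (beats u) S) S
    R = ∑ (λ u → bit (beats u x)) S
    one : ∀ u → 1 ≤ bit (beats x u) + bit (beats u x)
    one u with arc T x u in xu | arc T u x in ux
    ... | true  | true  = contradiction ux (Arc-asym T xu)
    ... | true  | false = ≤-refl
    ... | false | true  = ≤-refl
    ... | false | false = s≤s z≤n
    pairs : L ≤ P + R
    pairs = subst (L ≤_) (∑-distrib-+ (λ u → bit (beats x u)) (λ u → bit (beats u x)) S) (length-≤-∑ one S)

  -- Averaging: if all `L` counts were at most half of `L`, twice their sum would be at most
  -- `L * L`, below the bound of `count-beats-total`.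
  half<count-beats : ∀ S → 1 ≤ length S → ∃[ u ] (u ∈ S × ⌊ length S /2⌋ < count (beats u) S)
  half<count-beats S 1≤L with Any.any? (λ u → ⌊ length S /2⌋ <? count (beats u) S) S
  ... | yes some = find some
  ... | no none = contradiction (count-beats-total S) (<⇒≱ (begin-strict
    2 * ∑ (λ u → count (beats u) S) S  ≤⟨ *-monoʳ-≤ 2 (∑-≤-length (All.map ≮⇒≥ (All.¬Any⇒All¬ S none))) ⟩
    2 * (L * h)                        ≡⟨ solve 2 (λ l h → con 2 :* (l :* h) := l :* (h :+ h)) refl L h ⟩
    L * (h + h)                        ≤⟨ *-monoʳ-≤ L (+-monoʳ-≤ h (⌊n/2⌋≤⌈n/2⌉ L)) ⟩
    L * (h + ⌈ L /2⌉)                  ≡⟨ cong (L *_) (⌊n/2⌋+⌈n/2⌉≡n L) ⟩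
    L * L                              <⟨ *-monoʳ-< L {{>-nonZero 1≤L}} (n<1+n L) ⟩
    L * suc L                          ∎))
    where
    open ≤-Reasoning
    L h : ℕ
    L = length S
    h = ⌊ L /2⌋

-- Bichromatic neighbourhoods

-- The first component selects one of two pairs of colours, the second a colour within that pair.
Colour : Set
Colour = Bool × Bool

_≟ᶜ_ : (c c′ : Colour) → Dec (c ≡ c′)
_≟ᶜ_ = ≡-dec Bool._≟_ Bool._≟_

hasColour : Colour → Maybe Colour → Bool
hasColour c nothing   = false
hasColour c (just c′) = does (c ≟ᶜ c′)

module _ {n : ℕ} where

  Partial : Set
  Partial = Fin n → Maybe Colour

  class : Partial → Colour → ℕ
  class κ c = # (hasColour c ∘ κ)

  Extends : Partial → Partial → Set
  Extends κ κ′ = ∀ x {c} → κ x ≡ just c → κ′ x ≡ just c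

  Bichromatic : Partial → (Fin n → Bool) → Set
  Bichromatic κ W = ∃[ x ] ∃[ y ] ∃[ c ] ∃[ c′ ]
    (W x ≡ true × W y ≡ true × κ x ≡ just c × κ y ≡ just c′ × c ≢ c′)

  bichromatic-extends : ∀ {κ κ′ W} → Extends κ κ′ → Bichromatic κ W → Bichromatic κ′ W
  bichromatic-extends ext (x , y , c , c′ , wx , wy , κx , κy , c≢c′) =
    x , y , c , c′ , wx , wy , ext x κx , ext y κy , c≢c′

  paint : Partial → Fin n → Colour → Partial
  paint κ x c y = if does (x ≟ᶠ y) then just c else κ y

  paint-≡ : ∀ κ x c → paint κ x c x ≡ just c
  paint-≡ κ x c with x ≟ᶠ x
  ... | yes _  = refl
  ... | no x≢x = contradiction refl x≢x

  paint-≢ : ∀ κ {x y} c → x ≢ y → paint κ x c y ≡ κ y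
  paint-≢ κ {x} {y} c x≢y with x ≟ᶠ y
  ... | yes x≡y = contradiction x≡y x≢y
  ... | no _    = refl

  paint-extends : ∀ κ x c → κ x ≡ nothing → Extends κ (paint κ x c)
  paint-extends κ x c blank y κy with x ≟ᶠ y
  ... | yes refl with () ← trans (sym blank) κy
  ... | no _ = κy

  class-paint : ∀ κ x c c′ → class (paint κ x c) c′ ≤ suc (class κ c′)
  class-paint κ x c c′ = begin
    class (paint κ x c) c′                                           ≤⟨ ∑-mono pointwise (allFin n) ⟩
    ∑ (λ y → bit (is x y) + bit (hasColour c′ (κ y))) (allFin n)     ≡⟨ ∑-distrib-+ (bit ∘ is x) _ (allFin n) ⟩
    # (is x) + class κ c′                                            ≤⟨ +-monoˡ-≤ (class κ c′) (#-is≤1 x) ⟩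
    suc (class κ c′)                                                 ∎
    where
    open ≤-Reasoning
    bit≤1 : ∀ b → bit b ≤ 1
    bit≤1 true  = ≤-refl
    bit≤1 false = z≤n
    pointwise : ∀ y → bit (hasColour c′ (paint κ x c y)) ≤ bit (is x y) + bit (hasColour c′ (κ y))
    pointwise y with x ≟ᶠ y
    ... | yes _ = m≤n⇒m≤n+o _ (bit≤1 _)
    ... | no _  = ≤-refl

  class-paint-≢ : ∀ κ x {c c′} → c′ ≢ c → class (paint κ x c) c′ ≤ class κ c′
  class-paint-≢ κ x {c} {c′} c′≢c = ∑-mono pointwise (allFin n)
    where
    pointwise : ∀ y → bit (hasColour c′ (paint κ x c y)) ≤ bit (hasColour c′ (κ y))
    pointwise y with x ≟ᶠ y
    ... | no _ = ≤-refl
    ... | yes _ with c′ ≟ᶜ c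
    ...   | yes c′≡c = contradiction c′≡c c′≢c
    ...   | no _     = z≤n

  -- Only colours with first component π are used for new vertices.
  extend-bichromatic : ∀ κ W π → 2 ≤ # W → (∀ c → class κ c < # W) →
    ∃[ κ′ ] (Extends κ κ′ × Bichromatic κ′ W ×
             (∀ c → class κ′ c ≤ suc (class κ c)) × (∀ b → class κ′ (not π , b) ≤ class κ (not π , b)))
  extend-bichromatic κ W π 2≤#W small
    with any? (λ x → (W x Bool.≟ true) ×-dec Maybe.≡-dec _≟ᶜ_ (κ x) nothing)
  -- All of `W` is coloured; as every class is smaller than `W`, two colours occur in it already.
  extend-bichromatic κ W π 2≤#W small | no full
    with x , wx ← count-≥1⇒∃ (allFin n) (≤-trans (s≤s z≤n) 2≤#W)
    with κ x in κx
  ... | nothing = contradiction (x , wx , κx) full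
  ... | just c
    with y , wy , differ ← count-<⇒∃ (allFin n) (small c)
    with κ y in κy
  ...   | nothing = contradiction (y , wy , κy) full
  ...   | just c′ with c ≟ᶜ c′
  ...     | no c≢c′ = κ , (λ _ → id) , (x , y , c , c′ , wx , wy , κx , κy , c≢c′) , (λ _ → n≤1+n _) , λ _ → ≤-refl
  ...     | yes _ with () ← differ
  extend-bichromatic κ W π 2≤#W small | yes (x , wx , κx)
    with y , wy , differ ← count-<⇒∃ (allFin n) (≤-<-trans (#-is≤1 x) 2≤#W)
    with x ≟ᶠ y
  ... | yes _ with () ← differ
  ... | no x≢y with κ y in κy
  -- The second component `not b` separates `x` from `y` whatever `a` is.
  ...   | just (a , b) =
    paint κ x new , paint-extends κ x new κx ,
    (x , y , new , (a , b) , wx , wy , paint-≡ κ x new , paint-extends κ x new κx y κy ,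
      λ eq → Bool.not-¬ refl (cong proj₂ (sym eq))) ,
    class-paint κ x new , λ _ → class-paint-≢ κ x (λ eq → Bool.not-¬ refl (cong proj₁ (sym eq)))
    where
    new : Colour
    new = π , not b
  -- Each colour of the pair is used once, so no class grows by more than one.
  ...   | nothing =
    paint κ₁ y (π , false) , (λ z → paint-extends κ₁ y _ κ₁y z ∘ paint-extends κ x _ κx z) ,
    (x , y , (π , true) , (π , false) , wx , wy , paint-extends κ₁ y _ κ₁y x (paint-≡ κ x _) , paint-≡ κ₁ y _ , λ ()) ,
    grow , λ _ → ≤-trans (class-paint-≢ κ₁ y (λ eq → Bool.not-¬ refl (cong proj₁ (sym eq))))
                         (class-paint-≢ κ x (λ eq → Bool.not-¬ refl (cong proj₁ (sym eq))))
    where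
    κ₁ : Partial
    κ₁ = paint κ x (π , true)
    κ₁y : κ₁ y ≡ nothing
    κ₁y = trans (paint-≢ κ _ x≢y) κy
    grow : ∀ c → class (paint κ₁ y (π , false)) c ≤ suc (class κ c)
    grow c with c ≟ᶜ (π , false)
    ... | yes refl = ≤-trans (class-paint κ₁ y _ _) (s≤s (class-paint-≢ κ x λ ()))
    ... | no c≢    = ≤-trans (class-paint-≢ κ₁ y c≢) (class-paint κ x _ _)

module _ (T : Tournament n) (W : Fin n → Fin n → Bool) where

  -- The invariant after `m` vertices, with `π` the pair to use next. Its classes may grow to
  -- `suc ⌊ m /2⌋`, which is `⌈ suc m /2⌉`; the other pair, bounded by `⌈ m /2⌉`, which is
  -- `⌊ suc m /2⌋`, is next in turn.
  Balanced : ℕ → Partial {n} → Set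
  Balanced m κ = ∃[ π ] ((∀ b → class κ (π , b) ≤ ⌊ m /2⌋) × (∀ c → class κ c ≤ ⌈ m /2⌉))

  -- Greedy induction: the vertex with a large count is set aside and handled last, when its set
  -- `W u` still exceeds every class.
  balanced-bichromatic : ∀ m S → length S ≡ m → (∀ {u} → u ∈ S → count (beats T u) S ≤ # (W u)) →
    ∃[ κ ] (Balanced m κ × (∀ {u} → u ∈ S → 2 ≤ # (W u) → Bichromatic κ (W u)))
  balanced-bichromatic zero [] refl large =
    (λ _ → nothing) , (true , (λ _ → empty) , λ _ → empty) , λ ()
    where
    empty : count (λ _ → false) (allFin n) ≤ 0
    empty = ≤-trans (∑-≤-length (All.universal (λ _ → z≤n) (allFin n))) (≤-reflexive (*-zeroʳ (length (allFin n))))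
  balanced-bichromatic (suc m) S |S| large
    with u , u∈S , busy ← half<count-beats T S (subst (1 ≤_) (sym |S|) (s≤s z≤n))
    with ys , zs , refl ← ∈-∃++ u∈S
    with κ , (π , floor , ceil) , bichromatic ← balanced-bichromatic m (ys ++ zs)
           (suc-injective (trans (sym (↭-length (shift u ys zs))) |S|))
           -- Deleting `u` can only lower the counts, so the hypothesis passes to the shorter list.
           (λ {v} v∈ → ≤-trans (≤-trans (m≤n+m _ _) (≤-reflexive (sym (sum-↭ (↭-map⁺ (bit ∘ beats T v) (shift u ys zs))))))
                         (large (∈-resp-↭ (↭-sym (shift u ys zs)) (there v∈))))
    with 2 ≤? # (W u)
  -- No condition is imposed at `u`; `κ` stays and the pair is switched all the same.
  ... | no few = κ , (not π , (λ _ → ceil _) , λ c → ≤-trans (ceil c) (⌊n/2⌋-mono (n≤1+n (suc m)))) , bichromatic′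
    where
    bichromatic′ : ∀ {v} → v ∈ ys ++ u ∷ zs → 2 ≤ # (W v) → Bichromatic κ (W v)
    bichromatic′ v∈ with ∈-resp-↭ (shift u ys zs) v∈
    ... | here refl = λ many → contradiction many few
    ... | there v∈′ = bichromatic v∈′
  ... | yes many
    with κ′ , ext , bi , grow , keep ← extend-bichromatic κ (W u) π many
           -- `⌈ m /2⌉` is `⌊ suc m /2⌋`, which is below the count of `u` and so below `# (W u)`.
           (λ c → ≤-<-trans (ceil c) (<-≤-trans (subst (λ l → ⌊ l /2⌋ < count (beats T u) (ys ++ u ∷ zs)) |S| busy) (large u∈S))) =
    κ′ , (not π , (λ b → ≤-trans (keep b) (ceil _)) , ceil′) , bichromatic′
    where
    ceil′ : ∀ c → class κ′ c ≤ ⌈ suc m /2⌉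
    ceil′ (a , b) with a Bool.≟ π
    ... | yes refl = ≤-trans (grow _) (s≤s (floor b))
    ... | no a≢π rewrite Bool.¬-not a≢π = ≤-trans (keep b) (≤-trans (ceil _) (⌊n/2⌋-mono (n≤1+n (suc m))))
    bichromatic′ : ∀ {v} → v ∈ ys ++ u ∷ zs → 2 ≤ # (W v) → Bichromatic κ′ (W v)
    bichromatic′ v∈ with ∈-resp-↭ (shift u ys zs) v∈
    ... | here refl = λ _ → bi
    ... | there v∈′ = bichromatic-extends ext ∘ bichromatic v∈′

colourIndex : Colour → Fin 4
colourIndex (true  , true)  = zero
colourIndex (true  , false) = suc zero
colourIndex (false , true)  = suc (suc zero)
colourIndex (false , false) = suc (suc (suc zero))

indexColour : Fin 4 → Colour
indexColour zero                   = true  , true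
indexColour (suc zero)             = true  , false
indexColour (suc (suc zero))       = false , true
indexColour (suc (suc (suc zero))) = false , false

indexColour-colourIndex : ∀ c → indexColour (colourIndex c) ≡ c
indexColour-colourIndex (true  , true)  = refl
indexColour-colourIndex (true  , false) = refl
indexColour-colourIndex (false , true)  = refl
indexColour-colourIndex (false , false) = refl

colourIndex-injective : ∀ {c c′} → colourIndex c ≡ colourIndex c′ → c ≡ c′
colourIndex-injective {c} {c′} eq =
  trans (sym (indexColour-colourIndex c)) (trans (cong indexColour eq) (indexColour-colourIndex c′))

-- Consequences of minimum out-degree

module _ (T : Tournament n) (r : Fin n) (r-min : ∀ u → # (arc T r) ≤ # (arc T u)) where

  -- For an out-neighbour `u` of `r` this is W u: the out-neighbours of `u` at distance two from
  -- `r`.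
  exits : Fin n → Fin n → Bool
  exits u w = arc T u w ∧ not (arc T r w)

  outN : List (Fin n)
  outN = filterᵇ (arc T r) (allFin n)

  -- Cancelling the common out-neighbours from the out-degrees of `r` and `u` compares the two
  -- differences of their out-neighbourhoods.
  count-beats≤exits : ∀ u → count (beats T u) outN ≤ # (exits u)
  count-beats≤exits u = subst (_≤ # (exits u)) (sym (count-filter (beats T u) (arc T r) (allFin n)))
    (+-cancelˡ-≤ (# (arc T u)) _ _ (subst (_≤ # (arc T u) + # (exits u)) exchange (+-monoˡ-≤ (# (exits u)) (r-min u))))
    where
    bits : ∀ a b → bit a + bit (b ∧ not a) ≡ bit b + bit (a ∧ not b)
    bits true  true  = refl
    bits true  false = refl
    bits false true  = refl
    bits false false = refl
    exchange : # (arc T r) + # (exits u) ≡ # (arc T u) + # (λ x → arc T r x ∧ beats T u x)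
    exchange = trans (sym (∑-distrib-+ (bit ∘ arc T r) _ (allFin n)))
              (trans (∑-cong (λ x → bits (arc T r x) (arc T u x)) (allFin n))
                     (∑-distrib-+ (bit ∘ arc T u) _ (allFin n)))

  ∈-outN : ∀ {u} → Arc T r u → u ∈ outN
  ∈-outN {u} ru = ∈-filter⁺ (Bool.T? ∘ arc T r) (∈-allFin u) (subst Bool.T (sym ru) tt)

  Exit : Fin n → Fin n → Set
  Exit u w = Arc T u w × arc T r w ≡ false

  exit-split : ∀ {u w} → exits u w ≡ true → Exit u w
  exit-split {u} {w} e with arc T u w | arc T r w
  ... | true | false = refl , refl

  -- `u` itself is counted on the left of `count-beats≤exits`.
  exit : ∀ {u} → Arc T r u → ∃[ w ] Exit u w
  exit {u} ru with w , e ← count-≥1⇒∃ (allFin n)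
      (≤-trans (∈⇒count≥1 (∈-outN ru) (cong not (loopless T u))) (count-beats≤exits u)) =
    w , exit-split e

  -- An arc from `p` to `u` makes both `p` and `u` counted, so `u` has at least two exits and they
  -- are bichromatic; one of two different colours avoids `c`.
  exit-colouring : Σ (Fin n → Fin 4) λ χ → ∀ {u p} → Arc T r u → Arc T r p → Arc T p u →
                   ∀ c → ∃[ w ] (Exit u w × χ w ≢ c)
  exit-colouring with κ , _ , bichromatic ← balanced-bichromatic T exits _ outN refl (λ {u} _ → count-beats≤exits u) =
    χ , λ {u} {p} ru rp pu c → choose c (bichromatic (∈-outN ru)
      (≤-trans (∈∈⇒count≥2 (Arc⇒≢ T pu) (∈-outN rp) (∈-outN ru)
                 (cong not (Bool.¬-not (Arc-asym T pu))) (cong not (loopless T u)))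
               (count-beats≤exits u)))
    where
    χ : Fin n → Fin 4
    -- Blank vertices default to `zero`, which is harmless: the two witnesses of `Bichromatic` are
    -- coloured.
    χ v = maybe′ colourIndex zero (κ v)
    choose : ∀ {u} c → Bichromatic κ (exits u) → ∃[ w ] (Exit u w × χ w ≢ c)
    choose c (x , y , c₁ , c₂ , ex , ey , κx , κy , c₁≢c₂) with χ x ≟ᶠ c
    ... | no χx≢c = x , exit-split ex , χx≢c
    ... | yes χx≡c = y , exit-split ey , λ χy≡c → c₁≢c₂ (colourIndex-injective
      (trans (cong (maybe′ colourIndex zero) (sym κx)) (trans (trans χx≡c (sym χy≡c)) (cong (maybe′ colourIndex zero) κy))))

-- Diameter at least three

-- Level 2 is spread over the ranks 2 to 5, which shifts each later level up by three.
rank : ℕ → Fin 4 → ℕ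
rank 0                   c = 0
rank 1                   c = 1
rank 2                   c = 2 + toℕ c
rank (suc (suc (suc i))) c = 6 + i

-- Recovers the level from the rank, so distinct levels have distinct ranks.
unrank : ℕ → ℕ
unrank 0 = 0
unrank 1 = 1
unrank 2 = 2
unrank 3 = 2
unrank 4 = 2
unrank 5 = 2
unrank (suc (suc (suc (suc (suc (suc i)))))) = 3 + i

unrank-rank : ∀ i c → unrank (rank i c) ≡ i
unrank-rank 0                   c                          = refl
unrank-rank 1                   c                          = refl
unrank-rank 2                   zero                       = refl
unrank-rank 2                   (suc zero)                 = refl
unrank-rank 2                   (suc (suc zero))           = refl
unrank-rank 2                   (suc (suc (suc zero)))     = refl
unrank-rank (suc (suc (suc i))) c                          = refl

rank≤ : ∀ i c → rank i c ≤ i + 3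
rank≤ 0                   c = z≤n
rank≤ 1                   c = s≤s z≤n
rank≤ 2                   c = s≤s (s≤s (s≤s⁻¹ (toℕ<n c)))
rank≤ (suc (suc (suc i))) c = ≤-reflexive (cong (3 +_) (+-comm 3 i))

-- Exempts the last entry, as `internalColours` does.
Inner : {A : Set} → (A → Set) → List A → Set
Inner P []            = ⊤
Inner P (w ∷ [])      = ⊤
Inner P (w ∷ w′ ∷ ws) = P w × Inner P (w′ ∷ ws)

inner-∷ : ∀ {A : Set} {P : A → Set} {w} → P w → ∀ ws → Inner P ws → Inner P (w ∷ ws)
inner-∷ pw []       inner = tt
inner-∷ pw (_ ∷ ws) inner = pw , inner

all-internal : ∀ {T : Tournament n} (c : TotalColouring T k) {P : Fin k → Set} {ws} →
               All (P ∘ vertCol c) ws → All P (internalColours c ws)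
all-internal c []             = []
all-internal c (_ ∷ [])       = []
all-internal c (p ∷ ps@(_ ∷ _)) = p ∷ all-internal c ps

inner-internal : ∀ {T : Tournament n} (c : TotalColouring T k) {P : Fin k → Set} ws →
                 Inner (P ∘ vertCol c) ws → All P (internalColours c ws)
inner-internal c []            _           = []
inner-internal c (_ ∷ [])      _           = []
inner-internal c (_ ∷ w ∷ ws) (p , inner) = p ∷ inner-internal c (w ∷ ws) inner

unique-internal : ∀ {T : Tournament n} (c : TotalColouring T k) {ws} →
                  AllPairs (λ x y → vertCol c x ≢ vertCol c y) ws → Unique (internalColours c ws)
unique-internal c []                     = []
unique-internal c (_ ∷ [])               = []
unique-internal c (x≢ ∷ uniq@(_ ∷ _)) = all-internal c x≢ ∷ unique-internal c uniq

-- The value D is allowed although it also colours arcs with head of value 0: a vertex of value D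
-- can only be the last vertex of a Good path.
module Headed (T : Tournament n) (D : ℕ) (s : Fin n → ℕ) (s≤D : ∀ v → s v ≤ D) where

  colouring : TotalColouring T (suc (D + D))
  colouring = record
    { vertCol = λ v → fromℕ< (s≤s (m≤n⇒m≤o+n D (s≤D v)))
    ; arcCol  = λ u v → fromℕ< (s≤s (+-monoʳ-≤ D (s≤D v)))
    }

  toℕ-vertCol : ∀ v → toℕ (vertCol colouring v) ≡ s v
  toℕ-vertCol v = toℕ-fromℕ< _

  toℕ-arcCol : ∀ u v → toℕ (arcCol colouring u v) ≡ D + s v
  toℕ-arcCol u v = toℕ-fromℕ< _

  Separated : List (Fin n) → Set
  Separated = AllPairs (λ x y → s x ≢ s y)

  -- The start `u` enters `avoids` but not `separated`: neither its own colour nor an arc into it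
  -- appears on the path, so its value may recur.
  record Good (u : Fin n) (ws : List (Fin n)) (v : Fin n) : Set where
    constructor good
    field
      walk      : WalkFrom T u ws v
      avoids    : u ∉ ws
      separated : Separated ws
      inner     : Inner (λ w → s w < D) ws

  unique-arcColours : ∀ u {ws} → Separated ws → Unique (arcColours colouring u ws)
  unique-arcColours u []               = []
  unique-arcColours u {w ∷ _} (w≢ ∷ sep) = differ w w≢ ∷ unique-arcColours w sep
    where
    differ : ∀ x {ws} → All (λ y → s w ≢ s y) ws → All (arcCol colouring u w ≢_) (arcColours colouring x ws)
    differ x []                   = []
    differ x {y ∷ _} (w≢y ∷ w≢s) = (λ eq → w≢y (+-cancelˡ-≡ D _ _
      (trans (sym (toℕ-arcCol u w)) (trans (cong toℕ eq) (toℕ-arcCol x y))))) ∷ differ y w≢s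

  arcColours≥D : ∀ u ws → All (λ c → D ≤ toℕ c) (arcColours colouring u ws)
  arcColours≥D u []       = []
  arcColours≥D u (w ∷ ws) = ≤-trans (m≤m+n D (s w)) (≤-reflexive (sym (toℕ-arcCol u w))) ∷ arcColours≥D w ws

  -- Distinct values give distinct vertices and distinct colours within each palette; inner values
  -- below `D` keep the palettes apart.
  good⇒rainbow : ∀ {u ws v} → Good u ws v → IsPath T u ws v × TotalRainbow colouring u ws
  good⇒rainbow {u} {ws} (good walk u∉ sep inner) =
    (walk , ∉⇒All≢ u∉ ∷ AllPairs.map (λ s≢ eq → s≢ (cong s eq)) sep) ,
    Unique.++⁺ (unique-arcColours u sep)
      (unique-internal colouring (AllPairs.map (λ {x} {y} s≢ eq → s≢
        (trans (sym (toℕ-vertCol x)) (trans (cong toℕ eq) (toℕ-vertCol y)))) sep))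
      λ (∈arcs , ∈internal) → <⇒≱
        (All.lookup (inner-internal colouring {λ c → toℕ c < D} ws (inner-map ws inner)) ∈internal)
        (All.lookup (arcColours≥D u ws) ∈arcs)
    where
    inner-map : ∀ ws → Inner (λ w → s w < D) ws → Inner (λ w → toℕ (vertCol colouring w) < D) ws
    inner-map []            _           = tt
    inner-map (_ ∷ [])      _           = tt
    inner-map (w ∷ w′ ∷ ws) (p , inner) = subst (_< D) (sym (toℕ-vertCol w)) p , inner-map (w′ ∷ ws) inner

-- Distance levels from the root

module LargeDiameter (T : Tournament n) (3≤d : 3 ≤ d) (r : Fin n) (r-min : ∀ u → # (arc T r) ≤ # (arc T u))
                     (near : ∀ v → DistLE T r v d) where

  -- Reachability by at most `i` arcs, by recursion on `i` to make it decidable.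
  Within : ℕ → Fin n → Set
  Within zero    v = r ≡ v
  Within (suc i) v = Within i v ⊎ ∃[ u ] (Within i u × Arc T u v)

  within? : ∀ i v → Dec (Within i v)
  within? zero    v = r ≟ᶠ v
  within? (suc i) v = within? i v ⊎-dec any? λ u → within? i u ×-dec (arc T u v Bool.≟ true)

  within-walk : ∀ {i u} ws {v} → Within i u → WalkFrom T u ws v → Within (length ws + i) v
  within-walk         []       within refl        = within
  within-walk {i = i} (w ∷ ws) {v} within (uw , walk) =
    subst (λ m → Within m v) (+-suc (length ws) i) (within-walk ws (inj₂ (_ , within , uw)) walk)

  within-d : ∀ v → ∃[ i ] (Within i v × i ≤ d)
  within-d v with ws , (walk , _) , short ← near v =
    length ws + 0 , within-walk ws refl walk , subst (_≤ d) (sym (+-identityʳ _)) short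

  level-spec : ∀ v → ∃[ i ] (Within i v × (∀ j → Within j v → i ≤ j))
  level-spec v = least (λ i → within? i v) _ (proj₁ (proj₂ (within-d v)))

  level : Fin n → ℕ
  level v = proj₁ (level-spec v)

  level-within : ∀ v → Within (level v) v
  level-within v = proj₁ (proj₂ (level-spec v))

  level-min : ∀ {i v} → Within i v → level v ≤ i
  level-min {i} {v} = proj₂ (proj₂ (level-spec v)) i

  level≤d : ∀ v → level v ≤ d
  level≤d v with i , within , i≤d ← within-d v = ≤-trans (level-min within) i≤d

  level-arc : ∀ {u v} → Arc T u v → level v ≤ suc (level u)
  level-arc uv = level-min (inj₂ (_ , level-within _ , uv))

  level-0 : ∀ {v} → level v ≡ 0 → r ≡ v
  level-0 {v} eq = subst (λ i → Within i v) eq (level-within v)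

  level-r : level r ≡ 0
  level-r = n≤0⇒n≡0 (level-min refl)

  parent : ∀ {v i} → level v ≡ suc i → ∃[ u ] (Arc T u v × level u ≡ i)
  parent {v} {i} eq with subst (λ i → Within i v) eq (level-within v)
  ... | inj₁ within = contradiction (level-min within) (<⇒≱ (≤-reflexive (sym eq)))
  ... | inj₂ (u , within , uv) =
    u , uv , ≤-antisym (level-min within) (s≤s⁻¹ (subst (_≤ suc (level u)) eq (level-arc uv)))

  level-1⇒arc : ∀ {v} → level v ≡ 1 → Arc T r v
  level-1⇒arc eq with u , uv , u0 ← parent eq with refl ← level-0 u0 = uv

  arc⇒level-1 : ∀ {v} → Arc T r v → level v ≡ 1
  arc⇒level-1 {v} rv with level v in eq | subst (λ i → level v ≤ suc i) level-r (level-arc rv)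
  ... | 0           | _  = contradiction (level-0 eq) (Arc⇒≢ T rv)
  ... | 1           | _  = refl
  ... | suc (suc _) | s≤s ()

  -- Out-neighbours of `r` have level 1 and `r` has level 0, so here the arc must point to `r`.
  back : ∀ {v i} → level v ≡ suc (suc i) → Arc T v r
  back eq = Arc-total T (λ { refl → case trans (sym eq) level-r of λ () })
                        (λ rv → case trans (sym eq) (arc⇒level-1 rv) of λ ())

  exit-level : ∀ {u w} → Arc T r u → Exit T r r-min u w → level w ≡ 2
  exit-level {u} {w} ru (uw , ¬rw) with level w in eq | subst (λ i → level w ≤ suc i) (arc⇒level-1 ru) (level-arc uw)
  ... | 0                 | _ with refl ← level-0 eq = contradiction uw (Arc-asym T ru)
  ... | 1                 | _ with () ← trans (sym ¬rw) (level-1⇒arc eq)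
  ... | 2                 | _ = refl
  ... | suc (suc (suc _)) | s≤s (s≤s ())

  χ : Fin n → Fin 4
  χ = proj₁ (exit-colouring T r r-min)

  s : Fin n → ℕ
  s v = rank (level v) (χ v)

  s≤ : ∀ v → s v ≤ level v + 3
  s≤ v = rank≤ (level v) (χ v)

  level<d⇒s< : ∀ {v} → level v < d → s v < d + 3
  level<d⇒s< lt = ≤-<-trans (s≤ _) (+-monoˡ-< 3 lt)

  open Headed T (d + 3) s (λ v → ≤-trans (s≤ v) (+-monoˡ-≤ 3 (level≤d v)))

  level≢⇒s≢ : ∀ {x y} → level x ≢ level y → s x ≢ s y
  level≢⇒s≢ {x} {y} l≢ eq = l≢ (trans (sym (unrank-rank _ (χ x))) (trans (cong unrank eq) (unrank-rank _ (χ y))))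

  χ≢⇒s≢ : ∀ {x y} → level x ≡ 2 → level y ≡ 2 → χ x ≢ χ y → s x ≢ s y
  χ≢⇒s≢ x2 y2 χ≢ rewrite x2 | y2 = χ≢ ∘ toℕ-injective ∘ suc-injective ∘ suc-injective

  -- Descending a breadth-first tree

  data Ascent : Fin n → List (Fin n) → Fin n → Set where
    []  : ∀ {u} → Ascent u [] u
    asc : ∀ {u w ws v} → Arc T u w → level w ≡ suc (level u) → Ascent w ws v → Ascent u (w ∷ ws) v

  ascent-∷ʳ : ∀ {u ws v w} → Ascent u ws v → Arc T v w → level w ≡ suc (level v) → Ascent u (ws ∷ʳ w) w
  ascent-∷ʳ []             vw eq = asc vw eq []
  ascent-∷ʳ (asc ux eq′ a) vw eq = asc ux eq′ (ascent-∷ʳ a vw eq)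

  ascent-to : ∀ i {v} → level v ≡ i → ∃[ ws ] Ascent r ws v
  ascent-to zero    eq with refl ← level-0 eq = [] , []
  ascent-to (suc i) eq with u , uv , ui ← parent eq with ws , a ← ascent-to i ui =
    ws ∷ʳ _ , ascent-∷ʳ a uv (trans eq (cong suc (sym ui)))

  ascent-suffix : ∀ {u ws v x} → Ascent u ws v → x ∈ ws → ∃[ ws′ ] Ascent x ws′ v
  ascent-suffix (asc _ _ a) (here refl) = _ , a
  ascent-suffix (asc _ _ a) (there x∈)  = ascent-suffix a x∈

  ascent-walk : ∀ {u ws v} → Ascent u ws v → WalkFrom T u ws v
  ascent-walk []            = refl
  ascent-walk (asc uw _ a) = uw , ascent-walk a

  ascent-≤ : ∀ {u ws v} → Ascent u ws v → level u ≤ level v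
  ascent-≤ []            = ≤-refl
  ascent-≤ (asc _ eq a) = ≤-trans (≤-trans (n≤1+n _) (≤-reflexive (sym eq))) (ascent-≤ a)

  ascent-< : ∀ {u ws v} → Ascent u ws v → All (λ w → level u < level w) ws
  ascent-< []            = []
  ascent-< (asc _ eq a) = ≤-reflexive (sym eq) ∷ All.map (<-trans (≤-reflexive (sym eq))) (ascent-< a)

  ascent-s≢ : ∀ {u ws v} → Ascent u ws v → All (λ w → s u ≢ s w) ws
  ascent-s≢ a = All.map (level≢⇒s≢ ∘ <⇒≢) (ascent-< a)

  ascent-separated : ∀ {u ws v} → Ascent u ws v → Separated ws
  ascent-separated []           = []
  ascent-separated (asc _ _ a) = ascent-s≢ a ∷ ascent-separated a

  -- An internal vertex has a successor of higher level, so its own level is below `d`.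
  ascent-inner : ∀ {u ws v} → Ascent u ws v → Inner (λ w → s w < d + 3) ws
  ascent-inner []                            = tt
  ascent-inner (asc _ _ [])                  = tt
  ascent-inner (asc _ _ a@(asc _ eq a′)) =
    level<d⇒s< (<-≤-trans (≤-reflexive (sym eq)) (≤-trans (ascent-≤ a′) (level≤d _))) , ascent-inner a

  ascent-good : ∀ {u ws v} → Ascent u ws v → Good u ws v
  ascent-good a = good (ascent-walk a) (λ u∈ → <-irrefl refl (All.lookup (ascent-< a) u∈)) (ascent-separated a) (ascent-inner a)

  -- Paths that return through the root

  s-r : s r < d + 3
  s-r = level<d⇒s< (subst (_< d) (sym level-r) (≤-trans (s≤s z≤n) 3≤d))

  back-good : ∀ {u ws v} → Arc T u r → u ∉ ws → Ascent r ws v → Good u (r ∷ ws) v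
  back-good ur u∉ a = good (ur , ascent-walk a)
    (λ { (here u≡r) → Arc⇒≢ T ur u≡r ; (there u∈) → u∉ u∈ })
    (ascent-s≢ a ∷ ascent-separated a) (inner-∷ s-r _ (ascent-inner a))

  -- On an ascent from `r` the second vertex is the one of level 2. A shorter ascent has no such
  -- vertex and the default constrains nothing.
  secondColour : List (Fin n) → Fin 4
  secondColour (_ ∷ p₂ ∷ _) = χ p₂
  secondColour _            = zero

  -- Only the second vertex shares the level of `w`, and there `χ` separates them; elsewhere the
  -- levels do.
  exit-s≢ : ∀ {w ws v} → level w ≡ 2 → χ w ≢ secondColour ws → Ascent r ws v → All (λ x → s w ≢ s x) ws
  exit-s≢ w2 χ≢ []            = []
  exit-s≢ w2 χ≢ (asc _ eq₁ a) = level≢⇒s≢ (λ eq → case trans (sym w2) (trans eq p₁-level) of λ ()) ∷ rest a χ≢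
    where
    p₁-level = trans eq₁ (cong suc level-r)
    rest : ∀ {ws v} → Ascent _ ws v → χ _ ≢ secondColour (_ ∷ ws) → All (λ x → s _ ≢ s x) ws
    rest []            χ≢ = []
    rest (asc _ eq₂ a) χ≢ = χ≢⇒s≢ w2 p₂-level χ≢ ∷ All.map
        (λ lt → level≢⇒s≢ (λ eq → <⇒≢ lt (trans p₂-level (trans (sym w2) eq)))) (ascent-< a)
      where p₂-level = trans eq₂ (cong suc p₁-level)

  exit-good : ∀ {u w ws v} → Arc T r u → Exit T r r-min u w → u ∉ ws → Ascent r ws v → All (λ x → s w ≢ s x) ws →
              Good u (w ∷ r ∷ ws) v
  exit-good {w = w} ru e@(uw , _) u∉ a w≢ with exit-level ru e
  ... | w2 = good (uw , back w2 , ascent-walk a)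
    (λ { (here u≡w) → Arc⇒≢ T uw u≡w ; (there (here u≡r)) → Arc⇒≢ T ru (sym u≡r) ; (there (there u∈)) → u∉ u∈ })
    ((level≢⇒s≢ (λ eq → case trans (sym w2) (trans eq level-r) of λ ()) ∷ w≢) ∷ ascent-s≢ a ∷ ascent-separated a)
    (level<d⇒s< (subst (_< d) (sym w2) 3≤d) , inner-∷ s-r _ (ascent-inner a))

  join : ∀ u v → u ≢ v → ∃[ ws ] Good u ws v
  join u v u≢v with ws , a ← ascent-to (level v) refl with DecMembership._∈?_ _≟ᶠ_ u ws | level u in u-level
  -- The tree path to `v` passes through `u`; its remainder suffices.
  ... | yes u∈ | _ with ws′ , a′ ← ascent-suffix a u∈ = ws′ , ascent-good a′
  ... | no u∉  | zero with refl ← level-0 u-level = ws , ascent-good a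
  ... | no u∉  | suc (suc _) = r ∷ ws , back-good (back u-level) u∉ a
  ... | no u∉  | suc zero with a
  -- Here `v` is `r`, so any exit leads there.
  ...   | [] with w , e ← exit T r r-min (level-1⇒arc u-level) = w ∷ r ∷ [] , exit-good (level-1⇒arc u-level) e u∉ a []
  ...   | asc {w = p} rp _ a′ with arc T u p Bool.≟ true
  -- `u` replaces `r` as the start of the tree path.
  ...     | yes up = ws , good (up , ascent-walk a′) u∉ (ascent-separated a) (ascent-inner a)
  -- Now `p` leads to `u`, which is what `exit-colouring` requires for an exit whose colour differs
  -- from that of the second tree vertex.
  ...     | no ¬up
    with w , e , χ≢ ← proj₂ (exit-colouring T r r-min) (level-1⇒arc u-level) rp (Arc-total T (u∉ ∘ here) ¬up) (secondColour ws) =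
    w ∷ r ∷ ws , exit-good ru e u∉ a (exit-s≢ (exit-level ru e) χ≢ a)
    where ru = level-1⇒arc u-level

  connected : TotalRainbowConnected colouring
  connected u v u≢v with ws , g ← join u v u≢v = ws , good⇒rainbow g

minOutDegree : (T : Tournament n) → Fin n → ∃[ r ] (∀ u → # (arc T r) ≤ # (arc T u))
minOutDegree T x = Extrema.argmin out x (allFin _) , λ u → All.lookup (Extrema.f[argmin]≤f[xs] {f = out} x (allFin _)) (∈-allFin u)
  where
  out : Fin _ → ℕ
  out u = # (arc T u)

theorem20 : ∀ {n} (T : Tournament n) (d : ℕ) → HasDiameter T d →
    (d ≡ 2 → ∃[ k ] (IsTRC T k × 3 ≤ k × k ≤ 5)) ×
    (3 ≤ d → ∃[ k ] (IsTRC T k × 2 * d ∸ 1 ≤ k × k ≤ 2 * d + 7))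
theorem20 T d diam@(near , x , _) = diameter-two , large-diameter
  where
  diameter-two : d ≡ 2 → ∃[ k ] (IsTRC T k × 3 ≤ k × k ≤ 5)
  -- Every vertex can serve as centre; `x` comes from the diameter.
  diameter-two refl = trc-exists T diam _ (DiameterTwo.connected T x near)

  large-diameter : 3 ≤ d → ∃[ k ] (IsTRC T k × 2 * d ∸ 1 ≤ k × k ≤ 2 * d + 7)
  large-diameter 3≤d@(s≤s {n = e} _) with r , r-min ← minOutDegree T x
    with k , trc , lower , upper ← trc-exists T diam _ (LargeDiameter.connected T 3≤d r r-min (near r)) =
    k , trc ,
    subst (_≤ k) (solve 1 (λ e → con 1 :+ e :+ e := e :+ (con 1 :+ (e :+ con 0))) refl e) lower ,
    -- The palette size `suc (D + D)` at `D = d + 3`.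
    subst (k ≤_) (solve 1 (λ d → con 1 :+ ((d :+ con 3) :+ (d :+ con 3)) := con 2 :* d :+ con 7) refl d) upper
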